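{- Let $\mathcal{K}$ be the class of finite bounded lattices in the signature $\{\vee,\wedge,0,1\}$ and let $\mathbf{L}\in\mathcal{K}$ with $|L|\ge 2$. Then the class $\mathbb{H}^{\gets}_{\mathcal{K}}(\mathbf{L})$ of all finite bounded lattices admitting a homomorphism into $\mathbf{L}$ is strictly first-order definable relative to $\mathcal{K}$ (i.e. $\mathbb{H}^{\gets}_{\mathcal{K}}(\mathbf{L})=\mathcal{K}\cap\operatorname{Mod}(\phi)$ for some first-order sentence $\phi$), but it is not definable relative to $\mathcal{K}$ by any universal sentence.
   Context: Homomorphisms are homomorphisms of bounded lattices (preserving $\vee,\wedge,0,1$). $\operatorname{Mod}(\phi)$ denotes the class of models of $\phi$. -}

module Defs where

open import Data.Nat using (ℕ; zero; suc)
open import Data.Fin using (Fin; zero; suc)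
open import Data.Product using (Σ; _×_; _,_)
open import Data.Sum using (_⊎_)
open import Data.Empty using (⊥)
open import Data.Unit using (⊤)
open import Relation.Binary.PropositionalEquality using (_≡_)
open import Algebra.Core using (Op₂)
open import Algebra.Lattice.Structures using (IsLattice)
import Algebra.Definitions as AD

-- A finite bounded lattice, presented (up to isomorphism) on the carrier Fin size,
-- with equality the propositional equality of Fin size.
record FinBLat : Set where
  field
    size      : ℕ
    _∨_       : Op₂ (Fin size)
    _∧_       : Op₂ (Fin size)
    𝟘         : Fin size
    𝟙         : Fin size
    isLattice : IsLattice {A = Fin size} _≡_ _∨_ _∧_
    ∨-identity : AD.Identity {A = Fin size} _≡_ 𝟘 _∨_
    ∧-identity : AD.Identity {A = Fin size} _≡_ 𝟙 _∧_

open FinBLat public using (size)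

record IsHom (M L : FinBLat) (f : Fin (size M) → Fin (size L)) : Set where
  private
    module M = FinBLat M
    module L = FinBLat L
  field
    pres-∨ : ∀ x y → f (x M.∨ y) ≡ (f x L.∨ f y)
    pres-∧ : ∀ x y → f (x M.∧ y) ≡ (f x L.∧ f y)
    pres-𝟘 : f M.𝟘 ≡ L.𝟘
    pres-𝟙 : f M.𝟙 ≡ L.𝟙

HomTo : FinBLat → FinBLat → Set
HomTo M L = Σ (Fin (size M) → Fin (size L)) (IsHom M L)

data Term (k : ℕ) : Set where
  var  : Fin k → Term k
  _∨ₜ_ : Term k → Term k → Term k
  _∧ₜ_ : Term k → Term k → Term k
  0ₜ   : Term k
  1ₜ   : Term k

data Formula : ℕ → Set where
  _≐_   : ∀ {k} → Term k → Term k → Formula k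
  falsum : ∀ {k} → Formula k
  verum  : ∀ {k} → Formula k
  ¬ᶠ_   : ∀ {k} → Formula k → Formula k
  _∧ᶠ_  : ∀ {k} → Formula k → Formula k → Formula k
  _∨ᶠ_  : ∀ {k} → Formula k → Formula k → Formula k
  _⇒ᶠ_  : ∀ {k} → Formula k → Formula k → Formula k
  ∀ᶠ    : ∀ {k} → Formula (suc k) → Formula k
  ∃ᶠ    : ∀ {k} → Formula (suc k) → Formula k

Sentence : Set
Sentence = Formula zero

data QF : ∀ {k} → Formula k → Set where
  qf-eq  : ∀ {k} (s t : Term k) → QF (s ≐ t)
  qf-⊥   : ∀ {k} → QF (falsum {k})
  qf-⊤   : ∀ {k} → QF (verum {k})
  qf-¬   : ∀ {k} {φ : Formula k} → QF φ → QF (¬ᶠ φ)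
  qf-∧   : ∀ {k} {φ ψ : Formula k} → QF φ → QF ψ → QF (φ ∧ᶠ ψ)
  qf-∨   : ∀ {k} {φ ψ : Formula k} → QF φ → QF ψ → QF (φ ∨ᶠ ψ)
  qf-⇒   : ∀ {k} {φ ψ : Formula k} → QF φ → QF ψ → QF (φ ⇒ᶠ ψ)

data Universal : ∀ {k} → Formula k → Set where
  univ-qf : ∀ {k} {φ : Formula k} → QF φ → Universal φ
  univ-∀  : ∀ {k} {φ : Formula (suc k)} → Universal φ → Universal (∀ᶠ φ)

module _ (L : FinBLat) where
  open FinBLat L hiding (size)
  size′ = FinBLat.size L

  Env : ℕ → Set
  Env k = Fin k → Fin size′

  extend : ∀ {k} → Fin size′ → Env k → Env (suc k)
  extend a ρ zero    = a
  extend a ρ (suc i) = ρ i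

  evalT : ∀ {k} → Env k → Term k → Fin size′
  evalT ρ (var i)  = ρ i
  evalT ρ (s ∨ₜ t) = evalT ρ s ∨ evalT ρ t
  evalT ρ (s ∧ₜ t) = evalT ρ s ∧ evalT ρ t
  evalT ρ 0ₜ       = 𝟘
  evalT ρ 1ₜ       = 𝟙

  Sat : ∀ {k} → Env k → Formula k → Set
  Sat ρ (s ≐ t)  = evalT ρ s ≡ evalT ρ t
  Sat ρ falsum   = ⊥
  Sat ρ verum    = ⊤
  Sat ρ (¬ᶠ φ)   = Sat ρ φ → ⊥
  Sat ρ (φ ∧ᶠ ψ) = Sat ρ φ × Sat ρ ψ
  Sat ρ (φ ∨ᶠ ψ) = Sat ρ φ ⊎ Sat ρ ψ
  Sat ρ (φ ⇒ᶠ ψ) = Sat ρ φ → Sat ρ ψ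
  Sat ρ (∀ᶠ φ)   = (a : Fin size′) → Sat (extend a ρ) φ
  Sat ρ (∃ᶠ φ)   = Σ (Fin size′) (λ a → Sat (extend a ρ) φ)

_⊨_ : FinBLat → Sentence → Set
M ⊨ φ = Sat M (λ ()) φ

DefinesRel𝒦 : (FinBLat → Set) → Sentence → Set
DefinesRel𝒦 C φ = ∀ (M : FinBLat) → (C M → M ⊨ φ) × (M ⊨ φ → C M)

ℍ← : FinBLat → FinBLat → Set
ℍ← L M = HomTo M L

{-# OPTIONS --safe #-}

-- Definability: a homomorphism f : M → L is determined by the elements
-- α l = min { x | l ≤ f x }, because f x is then the unique l such that
-- m ≤ l ⇔ α m ≤ x for all m.  As L is finite, quantifying over α and expressing
-- that x ↦ l is a homomorphism is first order.
--
-- No universal sentence: stack n + 1 copies of the lattice with bottom, top and k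
-- pairwise complementary atoms, where k > |L|.  A homomorphism to L identifies two
-- atoms of each copy, hence collapses each copy, hence gives 𝟘 = 𝟙 in L.  But n
-- elements miss the atoms of some copy; deleting these leaves a sublattice with a
-- prime filter, which maps onto { 𝟘 , 𝟙 } ⊆ L.  So a sentence with n universal
-- quantifiers that holds in every lattice mapping to L holds in the whole stack.

module Submission where

open import Defs
open import Algebra.Lattice.Bundles using (Lattice; RawLattice)
import Algebra.Lattice.Morphism.LatticeMonomorphism as LatticeMonomorphism
import Algebra.Lattice.Properties.Lattice as LatticeProperties
open import Data.Empty using (⊥-elim)
open import Data.Fin using (Fin; zero; suc; toℕ)
open import Data.Fin.Properties as Fin
  using (_≟_; all?; any?; pigeonhole; ¬∀⟶∃¬; toℕ-injective; +↔⊎; 1↔⊤)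
open import Data.Nat as ℕ using (ℕ; zero; suc; _+_; _≤_)
open import Data.Nat.Properties using (n<1+n)
open import Data.Product using (Σ; ∃; ∃₂; _×_; _,_; proj₁; proj₂)
open import Data.Sum using (inj₁; inj₂)
open import Data.Sum.Function.Propositional using (_⊎-↔_)
open import Data.Unit using (tt)
open import Data.Vec using (Vec; []; _∷_; replicate; _[_]≔_)
open import Function using (_∘_; _↔_; mk↔ₛ′; Inverse)
open import Function.Properties.Inverse using (↔-refl; ↔-trans)
import Relation.Binary.Lattice as Ord
import Relation.Binary.Lattice.Properties.Lattice as OrdLatticeProperties
open import Relation.Binary.PropositionalEquality
  using (_≡_; _≢_; refl; sym; trans; cong; cong₂; subst; isEquivalence; module ≡-Reasoning)
open import Relation.Nullary using (¬_; Dec; yes; no)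
open import Relation.Nullary.Decidable using (¬?; decidable-stable)

-- Lattice order and finite meets

lattice : FinBLat → Lattice _ _
lattice L = record { isLattice = FinBLat.isLattice L }

-- In this order x ≼ y unfolds to x ≡ x ∧ y.
module Order (L : FinBLat) where
  open Ord.Lattice (LatticeProperties.∨-∧-orderTheoreticLattice (lattice L)) public
    using (antisym; ∧-greatest)
    renaming (_≤_ to _≼_; refl to ≼-refl; trans to ≼-trans; x∧y≤x to x∧y≼x; x∧y≤y to x∧y≼y)

  open FinBLat L using (_∧_; 𝟙; ∧-identity)

  ≼-𝟙 : ∀ x → x ≼ 𝟙
  ≼-𝟙 x = sym (proj₂ ∧-identity x)

  ⋂ : ∀ n → (Fin n → Fin (size L)) → Fin (size L)
  ⋂ zero    g = 𝟙
  ⋂ (suc n) g = g zero ∧ ⋂ n (g ∘ suc)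

  ⋂-lower : ∀ n g i → ⋂ n g ≼ g i
  ⋂-lower (suc n) g zero    = x∧y≼x _ _
  ⋂-lower (suc n) g (suc i) = ≼-trans (x∧y≼y (g zero) _) (⋂-lower n (g ∘ suc) i)

  ⋂-closed : (P : Fin (size L) → Set) → P 𝟙 → (∀ x y → P x → P y → P (x ∧ y)) →
             ∀ n g → (∀ i → P (g i)) → P (⋂ n g)
  ⋂-closed P P𝟙 P∧ zero    g Pg = P𝟙
  ⋂-closed P P𝟙 P∧ (suc n) g Pg =
    P∧ _ _ (Pg zero) (⋂-closed P P𝟙 P∧ n (g ∘ suc) (Pg ∘ suc))

-- Satisfaction

evalT-cong : ∀ M {k} {ρ σ : Env M k} → (∀ i → ρ i ≡ σ i) → ∀ t → evalT M ρ t ≡ evalT M σ t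
evalT-cong M e (var i)  = e i
evalT-cong M e (s ∨ₜ t) = cong₂ (FinBLat._∨_ M) (evalT-cong M e s) (evalT-cong M e t)
evalT-cong M e (s ∧ₜ t) = cong₂ (FinBLat._∧_ M) (evalT-cong M e s) (evalT-cong M e t)
evalT-cong M e 0ₜ       = refl
evalT-cong M e 1ₜ       = refl

extend-cong : ∀ M {k} {ρ σ : Env M k} → (∀ i → ρ i ≡ σ i) → ∀ a i → extend M a ρ i ≡ extend M a σ i
extend-cong M e a zero    = refl
extend-cong M e a (suc i) = e i

-- Environments are functions, so two that agree at every variable need not be propositionally
-- equal; this replaces function extensionality wherever an environment is rebuilt.
Sat-cong : ∀ M {k} {ρ σ : Env M k} → (∀ i → ρ i ≡ σ i) → ∀ φ → Sat M ρ φ → Sat M σ φ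
Sat-cong M e (s ≐ t)  p        = trans (sym (evalT-cong M e s)) (trans p (evalT-cong M e t))
Sat-cong M e verum    p        = p
Sat-cong M e (¬ᶠ φ)   p        = p ∘ Sat-cong M (sym ∘ e) φ
Sat-cong M e (φ ∧ᶠ ψ) (p , q)  = Sat-cong M e φ p , Sat-cong M e ψ q
Sat-cong M e (φ ∨ᶠ ψ) (inj₁ p) = inj₁ (Sat-cong M e φ p)
Sat-cong M e (φ ∨ᶠ ψ) (inj₂ q) = inj₂ (Sat-cong M e ψ q)
Sat-cong M e (φ ⇒ᶠ ψ) p        = Sat-cong M e ψ ∘ p ∘ Sat-cong M (sym ∘ e) φ
Sat-cong M e (∀ᶠ φ)   p        = λ a → Sat-cong M (extend-cong M e a) φ (p a)
Sat-cong M e (∃ᶠ φ)   (a , p)  = a , Sat-cong M (extend-cong M e a) φ p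

-- Finite conjunctions and disjunctions, existential closure

⋀ : ∀ {k} n → (Fin n → Formula k) → Formula k
⋀ zero    φ = verum
⋀ (suc n) φ = φ zero ∧ᶠ ⋀ n (φ ∘ suc)

⋁ : ∀ {k} n → (Fin n → Formula k) → Formula k
⋁ zero    φ = falsum
⋁ (suc n) φ = φ zero ∨ᶠ ⋁ n (φ ∘ suc)

∃⋆ : ∀ n → Formula n → Sentence
∃⋆ zero    φ = φ
∃⋆ (suc n) φ = ∃⋆ n (∃ᶠ φ)

-- `A` is a fact about the fixed lattice `L`, decided while the sentence is being built; the literal
-- then requires `φ` to have the same truth value in `M`.
literal : ∀ {k} {A : Set} → Dec A → Formula k → Formula k
literal (yes _) φ = φ
literal (no _)  φ = ¬ᶠ φ

module _ (M : FinBLat) where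
  ⋀⁺ : ∀ {k} {ρ : Env M k} n {φ : Fin n → Formula k} → (∀ i → Sat M ρ (φ i)) → Sat M ρ (⋀ n φ)
  ⋀⁺ zero    p = tt
  ⋀⁺ (suc n) p = p zero , ⋀⁺ n (p ∘ suc)

  ⋀⁻ : ∀ {k} {ρ : Env M k} n {φ : Fin n → Formula k} → Sat M ρ (⋀ n φ) → ∀ i → Sat M ρ (φ i)
  ⋀⁻ (suc n) (p , _) zero    = p
  ⋀⁻ (suc n) (_ , p) (suc i) = ⋀⁻ n p i

  ⋁⁺ : ∀ {k} {ρ : Env M k} n {φ : Fin n → Formula k} i → Sat M ρ (φ i) → Sat M ρ (⋁ n φ)
  ⋁⁺ (suc n) zero    p = inj₁ p
  ⋁⁺ (suc n) (suc i) p = inj₂ (⋁⁺ n i p)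

  ⋁⁻ : ∀ {k} {ρ : Env M k} n {φ : Fin n → Formula k} → Sat M ρ (⋁ n φ) → ∃ λ i → Sat M ρ (φ i)
  ⋁⁻ (suc n) (inj₁ p) = zero , p
  ⋁⁻ (suc n) (inj₂ p) = let i , q = ⋁⁻ n p in suc i , q

  ∃⋆⁺ : ∀ n {φ : Formula n} (ρ : Env M n) → Sat M ρ φ → M ⊨ ∃⋆ n φ
  ∃⋆⁺ zero    {φ} ρ p = Sat-cong M (λ ()) φ p
  ∃⋆⁺ (suc n) {φ} ρ p =
    ∃⋆⁺ n (ρ ∘ suc) (ρ zero , Sat-cong M (λ { zero → refl ; (suc i) → refl }) φ p)

  ∃⋆⁻ : ∀ n {φ : Formula n} → M ⊨ ∃⋆ n φ → ∃ λ ρ → Sat M ρ φ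
  ∃⋆⁻ zero    p = _ , p
  ∃⋆⁻ (suc n) p = let ρ , a , q = ∃⋆⁻ n p in extend M a ρ , q

  literal⁺ : ∀ {k} {ρ : Env M k} {A : Set} (d : Dec A) {φ : Formula k} →
             (A → Sat M ρ φ) → (Sat M ρ φ → A) → Sat M ρ (literal d φ)
  literal⁺ (yes a) f g = f a
  literal⁺ (no ¬a) f g = ¬a ∘ g

  literal⁻ : ∀ {k} {ρ : Env M k} {A : Set} (d : Dec A) {φ : Formula k} →
             Sat M ρ (literal d φ) → (A → Sat M ρ φ) × (Sat M ρ φ → A)
  literal⁻ (yes a) p = (λ _ → p) , (λ _ → a)
  literal⁻ (no ¬a) p = (⊥-elim ∘ ¬a) , (⊥-elim ∘ p)

-- The defining sentence

module Definability (L : FinBLat) where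
  open FinBLat L hiding (size)
  open Order L

  sL : ℕ
  sL = size L

  _≼?_ : ∀ l m → Dec (l ≼ m)
  l ≼? m = l ≟ (l ∧ m)

  -- First-order form of `f t = l`, where `α` codes `f`. The equation `α m ≐ (α m ∧ₜ t)` expresses
  -- `α m ≼ t`, and `m ≼ l` enters as a decided fact.
  valued : ∀ {k} → (Fin sL → Term k) → Fin sL → Term k → Formula k
  valued α l t = ⋀ sL λ m → literal (m ≼? l) (α m ≐ (α m ∧ₜ t))

  operationsPreserved : Formula (2 + sL)
  operationsPreserved = ⋁ sL λ l → ⋁ sL λ m →
    valued α l x ∧ᶠ (valued α m y ∧ᶠ
    (valued α (l ∨ m) (x ∨ₜ y) ∧ᶠ valued α (l ∧ m) (x ∧ₜ y)))
    where
    α : Fin sL → Term (2 + sL)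
    α m = var (suc (suc m))
    x y : Term (2 + sL)
    x = var (suc zero)
    y = var zero

  homSentence : Sentence
  homSentence = ∃⋆ sL
    (valued var 𝟘 0ₜ ∧ᶠ (valued var 𝟙 1ₜ ∧ᶠ ∀ᶠ (∀ᶠ operationsPreserved)))

  module _ (M : FinBLat) where
    private
      module M = FinBLat M
      module MO = Order M

    Valued : (Fin sL → Fin (size M)) → Fin sL → Fin (size M) → Set
    Valued a l x = ∀ m → (m ≼ l → a m MO.≼ x) × (a m MO.≼ x → m ≼ l)

    -- Taking `m` to be `l` and then `l′` puts each of the two below the other.
    Valued-unique : ∀ {a l l′ x} → Valued a l x → Valued a l′ x → l ≡ l′
    Valued-unique {l = l} {l′} p q =
      antisym (proj₂ (q l) (proj₁ (p l) ≼-refl)) (proj₂ (p l′) (proj₁ (q l′) ≼-refl))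

    valued⁺ : ∀ {k} {ρ : Env M k} (α : Fin sL → Term k) l t →
              Valued (evalT M ρ ∘ α) l (evalT M ρ t) → Sat M ρ (valued α l t)
    valued⁺ α l t v = ⋀⁺ M sL λ m → literal⁺ M (m ≼? l) (proj₁ (v m)) (proj₂ (v m))

    valued⁻ : ∀ {k} {ρ : Env M k} (α : Fin sL → Term k) l t →
              Sat M ρ (valued α l t) → Valued (evalT M ρ ∘ α) l (evalT M ρ t)
    valued⁻ α l t p m = literal⁻ M (m ≼? l) (⋀⁻ M sL p m)

    module FromHom {f : Fin (size M) → Fin sL} (f-hom : IsHom M L f) where
      open IsHom f-hom

      mono : ∀ {x y} → x MO.≼ y → f x ≼ f y
      mono {x} {y} x≼y = trans (cong f x≼y) (pres-∧ x y)

      -- The minimum of all `x` with `l ≼ f x` is computed as a meet over the whole carrier.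
      -- Elements outside this set are replaced by `𝟙`, which belongs to it and is neutral for
      -- meets.
      candidate : Fin sL → Fin (size M) → Fin (size M)
      candidate l x with l ≼? f x
      ... | yes _ = x
      ... | no  _ = M.𝟙

      l≼f𝟙 : ∀ l → l ≼ f M.𝟙
      l≼f𝟙 l = subst (l ≼_) (sym pres-𝟙) (≼-𝟙 l)

      candidate-above : ∀ l x → l ≼ f (candidate l x)
      candidate-above l x with l ≼? f x
      ... | yes l≼fx = l≼fx
      ... | no  _    = l≼f𝟙 l

      candidate-self : ∀ l x → l ≼ f x → candidate l x ≡ x
      candidate-self l x l≼fx with l ≼? f x
      ... | yes _   = refl
      ... | no l≰fx = ⊥-elim (l≰fx l≼fx)

      least : Fin sL → Fin (size M)
      least l = MO.⋂ (size M) (candidate l)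

      least-above : ∀ l → l ≼ f (least l)
      least-above l = MO.⋂-closed (λ x → l ≼ f x) (l≼f𝟙 l)
        (λ x y l≼fx l≼fy → subst (l ≼_) (sym (pres-∧ x y)) (∧-greatest l≼fx l≼fy))
        (size M) (candidate l) (candidate-above l)

      -- This is the Galois connection making `least` the left adjoint of `f`: if `m ≼ f x`, then
      -- `x` is one of the elements whose meet is `least m`; the converse is monotonicity of `f`.
      least-valued : ∀ x → Valued least (f x) x
      least-valued x m =
        (λ m≼fx → subst (least m MO.≼_) (candidate-self m x m≼fx)
                    (MO.⋂-lower (size M) (candidate m) x)) ,
        (λ least≼x → ≼-trans (least-above m) (mono least≼x))

      at : ∀ {l x} → f x ≡ l → Valued least l x
      at {x = x} refl = least-valued x

      satisfied : M ⊨ homSentence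
      satisfied = ∃⋆⁺ M sL least
        ( valued⁺ var 𝟘 0ₜ (at pres-𝟘)
        , valued⁺ var 𝟙 1ₜ (at pres-𝟙)
        , λ x y → ⋁⁺ M sL (f x) (⋁⁺ M sL (f y)
            ( valued⁺ _ (f x) _ (at refl)
            , valued⁺ _ (f y) _ (at refl)
            , valued⁺ _ (f x ∨ f y) _ (at (pres-∨ x y))
            , valued⁺ _ (f x ∧ f y) _ (at (pres-∧ x y)))))

    toHom : M ⊨ homSentence → HomTo M L
    toHom p with ∃⋆⁻ M sL p
    ... | a , v𝟘 , v𝟙 , v = f , record
      { pres-∨ = λ x y → let l , m , vx , vy , v∨ , v∧ = values x y in
          trans (f-at v∨) (sym (cong₂ _∨_ (f-at vx) (f-at vy)))
      ; pres-∧ = λ x y → let l , m , vx , vy , v∨ , v∧ = values x y in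
          trans (f-at v∧) (sym (cong₂ _∧_ (f-at vx) (f-at vy)))
      ; pres-𝟘 = f-at (valued⁻ var 𝟘 0ₜ v𝟘)
      ; pres-𝟙 = f-at (valued⁻ var 𝟙 1ₜ v𝟙)
      }
      where
      values : ∀ x y → ∃₂ λ l m → Valued a l x × Valued a m y ×
               Valued a (l ∨ m) (x M.∨ y) × Valued a (l ∧ m) (x M.∧ y)
      values x y =
        let l , q = ⋁⁻ M sL (v x y)
            m , vx , vy , v∨ , v∧ = ⋁⁻ M sL q
        in l , m , valued⁻ _ l _ vx , valued⁻ _ m _ vy
             , valued⁻ _ (l ∨ m) _ v∨ , valued⁻ _ (l ∧ m) _ v∧

      -- The disjunctions give values to pairs, so the diagonal pair supplies the value of a single
      -- element. By uniqueness, `f-at` makes it agree with the value found in any other pair.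
      f : Fin (size M) → Fin sL
      f x = proj₁ (values x x)

      f-at : ∀ {l x} → Valued a l x → f x ≡ l
      f-at {x = x} vx = let _ , _ , vx′ , _ = values x x in Valued-unique vx′ vx

  homSentence-defines : DefinesRel𝒦 (ℍ← L) homSentence
  homSentence-defines M = (λ (f , f-hom) → FromHom.satisfied M f-hom) , toHom M

-- Universal sentences

arity : ∀ {k} {φ : Formula k} → Universal φ → ℕ
arity {k} (univ-qf _) = k
arity     (univ-∀ u)  = arity u

matrix : ∀ {k} {φ : Formula k} (u : Universal φ) → Formula (arity u)
matrix {φ = φ} (univ-qf _) = φ
matrix         (univ-∀ u)  = matrix u

matrix-QF : ∀ {k} {φ : Formula k} (u : Universal φ) → QF (matrix u)
matrix-QF (univ-qf q) = q
matrix-QF (univ-∀ u)  = matrix-QF u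

weaken : ∀ {k} {φ : Formula k} (u : Universal φ) → Fin k → Fin (arity u)
weaken (univ-qf _) i = i
weaken (univ-∀ u)  i = weaken u (suc i)

module _ (M : FinBLat) where
  -- With its converse `universal⁻`, this strips the whole quantifier prefix at once: `xs` ranges
  -- over all environments of the matrix that agree with `ρ` on the free variables, located there by
  -- `weaken`. For a sentence, `arity` is the number of quantifiers.
  universal⁺ : ∀ {k} {φ : Formula k} (u : Universal φ) (ρ : Env M k) →
    (∀ xs → (∀ i → xs (weaken u i) ≡ ρ i) → Sat M xs (matrix u)) → Sat M ρ φ
  universal⁺ (univ-qf _) ρ p = p ρ (λ _ → refl)
  universal⁺ (univ-∀ u)  ρ p = λ a →
    universal⁺ u (extend M a ρ) (λ xs e → p xs (e ∘ suc))

  universal⁻ : ∀ {k} {φ : Formula k} (u : Universal φ) (ρ : Env M k) → Sat M ρ φ →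
    ∀ xs → (∀ i → xs (weaken u i) ≡ ρ i) → Sat M xs (matrix u)
  universal⁻ (univ-qf {φ = φ} _) ρ p xs e = Sat-cong M (sym ∘ e) φ p
  universal⁻ (univ-∀ u)          ρ p xs e =
    -- The outermost quantifier is instantiated with the value that `xs` gives to the variable it
    -- binds.
    universal⁻ u (extend M (xs (weaken u zero)) ρ) (p _) xs
      (λ { zero → refl ; (suc i) → e i })

-- Embeddings and quantifier-free formulas

module Embedding {N M : FinBLat} {h : Fin (size N) → Fin (size M)}
                 (h-hom : IsHom N M h) (h-inj : ∀ {x y} → h x ≡ h y → x ≡ y) where
  open IsHom h-hom

  evalT-hom : ∀ {k} {ρ : Env N k} {σ : Env M k} → (∀ i → h (ρ i) ≡ σ i) →
              ∀ t → h (evalT N ρ t) ≡ evalT M σ t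
  evalT-hom e (var i)  = e i
  evalT-hom e (s ∨ₜ t) =
    trans (pres-∨ _ _) (cong₂ (FinBLat._∨_ M) (evalT-hom e s) (evalT-hom e t))
  evalT-hom e (s ∧ₜ t) =
    trans (pres-∧ _ _) (cong₂ (FinBLat._∧_ M) (evalT-hom e s) (evalT-hom e t))
  evalT-hom e 0ₜ       = pres-𝟘
  evalT-hom e 1ₜ       = pres-𝟙

  module _ {k} {ρ : Env N k} {σ : Env M k} (e : ∀ i → h (ρ i) ≡ σ i) where
    -- Negation and implication reverse the direction, so preservation and reflection are proved
    -- together. Injectivity enters when equations are reflected.
    QF-preserved : ∀ {φ} → QF φ → Sat N ρ φ → Sat M σ φ
    QF-reflected : ∀ {φ} → QF φ → Sat M σ φ → Sat N ρ φ

    QF-preserved (qf-eq s t) p        = trans (sym (evalT-hom e s)) (trans (cong h p) (evalT-hom e t))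
    QF-preserved qf-⊤        p        = p
    QF-preserved (qf-¬ a)    p        = p ∘ QF-reflected a
    QF-preserved (qf-∧ a b)  (p , q)  = QF-preserved a p , QF-preserved b q
    QF-preserved (qf-∨ a b)  (inj₁ p) = inj₁ (QF-preserved a p)
    QF-preserved (qf-∨ a b)  (inj₂ q) = inj₂ (QF-preserved b q)
    QF-preserved (qf-⇒ a b)  p        = QF-preserved b ∘ p ∘ QF-reflected a

    QF-reflected (qf-eq s t) p        = h-inj (trans (evalT-hom e s) (trans p (sym (evalT-hom e t))))
    QF-reflected qf-⊤        p        = p
    QF-reflected (qf-¬ a)    p        = p ∘ QF-preserved a
    QF-reflected (qf-∧ a b)  (p , q)  = QF-reflected a p , QF-reflected b q
    QF-reflected (qf-∨ a b)  (inj₁ p) = inj₁ (QF-reflected a p)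
    QF-reflected (qf-∨ a b)  (inj₂ q) = inj₂ (QF-reflected b q)
    QF-reflected (qf-⇒ a b)  p        = QF-reflected b ∘ p ∘ QF-preserved a

-- Stacked lattices

-- The top of each block is the bottom of the block above it.
data Stack : ∀ {n} → Vec ℕ n → Set where
  top  : Stack []
  bot  : ∀ {n k} {ks : Vec ℕ n} → Stack (k ∷ ks)
  atom : ∀ {n k} {ks : Vec ℕ n} → Fin k → Stack (k ∷ ks)
  up   : ∀ {n k} {ks : Vec ℕ n} → Stack ks → Stack (k ∷ ks)

least : ∀ {n} {ks : Vec ℕ n} → Stack ks
least {ks = []}    = top
least {ks = _ ∷ _} = bot

greatest : ∀ {n} {ks : Vec ℕ n} → Stack ks
greatest {ks = []}    = top
greatest {ks = _ ∷ _} = up greatest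

infixr 6 _⊔_
infixr 7 _⊓_
infix 4 _⊑_

_⊔_ : ∀ {n} {ks : Vec ℕ n} → Stack ks → Stack ks → Stack ks
top    ⊔ top    = top
bot    ⊔ y      = y
atom i ⊔ bot    = atom i
atom i ⊔ atom j with i ≟ j
... | yes _     = atom i
... | no  _     = up least
atom i ⊔ up y   = up y
up x   ⊔ bot    = up x
up x   ⊔ atom j = up x
up x   ⊔ up y   = up (x ⊔ y)

_⊓_ : ∀ {n} {ks : Vec ℕ n} → Stack ks → Stack ks → Stack ks
top    ⊓ top    = top
bot    ⊓ y      = bot
atom i ⊓ bot    = bot
atom i ⊓ atom j with i ≟ j
... | yes _     = atom i
... | no  _     = bot
atom i ⊓ up y   = atom i
up x   ⊓ bot    = bot
up x   ⊓ atom j = atom j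
up x   ⊓ up y   = up (x ⊓ y)

-- The order is given independently of the operations, so that `⊔` and `⊓` can be verified as
-- suprema and infima; the lattice equations then follow from these universal properties rather than
-- from cases on triples of elements.
data _⊑_ : ∀ {n} {ks : Vec ℕ n} → Stack ks → Stack ks → Set where
  top⊑top   : top ⊑ top
  bot⊑      : ∀ {n k} {ks : Vec ℕ n} {y : Stack (k ∷ ks)} → bot ⊑ y
  atom⊑atom : ∀ {n k} {ks : Vec ℕ n} {i : Fin k} → atom {ks = ks} i ⊑ atom i
  atom⊑up   : ∀ {n k} {ks : Vec ℕ n} {i : Fin k} {y : Stack ks} → atom i ⊑ up y
  up⊑up     : ∀ {n k} {ks : Vec ℕ n} {x y : Stack ks} → x ⊑ y → up {k = k} x ⊑ up y

⊑-refl : ∀ {n} {ks : Vec ℕ n} {x : Stack ks} → x ⊑ x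
⊑-refl {x = top}    = top⊑top
⊑-refl {x = bot}    = bot⊑
⊑-refl {x = atom i} = atom⊑atom
⊑-refl {x = up x}   = up⊑up ⊑-refl

⊑-trans : ∀ {n} {ks : Vec ℕ n} {x y z : Stack ks} → x ⊑ y → y ⊑ z → x ⊑ z
⊑-trans top⊑top   q         = q
⊑-trans bot⊑      q         = bot⊑
⊑-trans atom⊑atom q         = q
⊑-trans atom⊑up   (up⊑up q) = atom⊑up
⊑-trans (up⊑up p) (up⊑up q) = up⊑up (⊑-trans p q)

⊑-antisym : ∀ {n} {ks : Vec ℕ n} {x y : Stack ks} → x ⊑ y → y ⊑ x → x ≡ y
⊑-antisym top⊑top   q         = refl
⊑-antisym bot⊑      bot⊑      = refl
⊑-antisym atom⊑atom q         = refl
⊑-antisym (up⊑up p) (up⊑up q) = cong up (⊑-antisym p q)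

least⊑ : ∀ {n} {ks : Vec ℕ n} {x : Stack ks} → least ⊑ x
least⊑ {ks = []} {top} = top⊑top
least⊑ {ks = _ ∷ _}    = bot⊑

x⊑x⊔y : ∀ {n} {ks : Vec ℕ n} (x y : Stack ks) → x ⊑ x ⊔ y
x⊑x⊔y top      top      = top⊑top
x⊑x⊔y bot      y        = bot⊑
x⊑x⊔y (atom i) bot      = atom⊑atom
x⊑x⊔y (atom i) (atom j) with i ≟ j
... | yes _ = atom⊑atom
... | no  _ = atom⊑up
x⊑x⊔y (atom i) (up y)   = atom⊑up
x⊑x⊔y (up x)   bot      = ⊑-refl
x⊑x⊔y (up x)   (atom j) = ⊑-refl
x⊑x⊔y (up x)   (up y)   = up⊑up (x⊑x⊔y x y)

y⊑x⊔y : ∀ {n} {ks : Vec ℕ n} (x y : Stack ks) → y ⊑ x ⊔ y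
y⊑x⊔y top      top      = top⊑top
y⊑x⊔y bot      y        = ⊑-refl
y⊑x⊔y (atom i) bot      = bot⊑
y⊑x⊔y (atom i) (atom j) with i ≟ j
... | yes refl = atom⊑atom
... | no  _    = atom⊑up
y⊑x⊔y (atom i) (up y)   = ⊑-refl
y⊑x⊔y (up x)   bot      = bot⊑
y⊑x⊔y (up x)   (atom j) = atom⊑up
y⊑x⊔y (up x)   (up y)   = up⊑up (y⊑x⊔y x y)

⊔-least : ∀ {n} {ks : Vec ℕ n} {x y z : Stack ks} → x ⊑ z → y ⊑ z → x ⊔ y ⊑ z
⊔-least top⊑top   top⊑top   = top⊑top
⊔-least bot⊑      q         = q
⊔-least atom⊑atom bot⊑      = atom⊑atom
⊔-least {x = atom i} atom⊑atom atom⊑atom with i ≟ i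
... | yes _  = atom⊑atom
... | no i≢i = ⊥-elim (i≢i refl)
⊔-least atom⊑up   bot⊑      = atom⊑up
⊔-least {x = atom i} {atom j} atom⊑up atom⊑up with i ≟ j
... | yes _ = atom⊑up
... | no  _ = up⊑up least⊑
⊔-least atom⊑up   (up⊑up q) = up⊑up q
⊔-least (up⊑up p) bot⊑      = up⊑up p
⊔-least (up⊑up p) atom⊑up   = up⊑up p
⊔-least (up⊑up p) (up⊑up q) = up⊑up (⊔-least p q)

x⊓y⊑x : ∀ {n} {ks : Vec ℕ n} (x y : Stack ks) → x ⊓ y ⊑ x
x⊓y⊑x top      top      = top⊑top
x⊓y⊑x bot      y        = bot⊑
x⊓y⊑x (atom i) bot      = bot⊑
x⊓y⊑x (atom i) (atom j) with i ≟ j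
... | yes _ = atom⊑atom
... | no  _ = bot⊑
x⊓y⊑x (atom i) (up y)   = atom⊑atom
x⊓y⊑x (up x)   bot      = bot⊑
x⊓y⊑x (up x)   (atom j) = atom⊑up
x⊓y⊑x (up x)   (up y)   = up⊑up (x⊓y⊑x x y)

x⊓y⊑y : ∀ {n} {ks : Vec ℕ n} (x y : Stack ks) → x ⊓ y ⊑ y
x⊓y⊑y top      top      = top⊑top
x⊓y⊑y bot      y        = bot⊑
x⊓y⊑y (atom i) bot      = bot⊑
x⊓y⊑y (atom i) (atom j) with i ≟ j
... | yes refl = atom⊑atom
... | no  _    = bot⊑
x⊓y⊑y (atom i) (up y)   = atom⊑up
x⊓y⊑y (up x)   bot      = bot⊑
x⊓y⊑y (up x)   (atom j) = atom⊑atom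
x⊓y⊑y (up x)   (up y)   = up⊑up (x⊓y⊑y x y)

⊓-greatest : ∀ {n} {ks : Vec ℕ n} {x y z : Stack ks} → z ⊑ x → z ⊑ y → z ⊑ x ⊓ y
⊓-greatest top⊑top   top⊑top   = top⊑top
⊓-greatest bot⊑      q         = bot⊑
⊓-greatest {z = atom i} atom⊑atom atom⊑atom with i ≟ i
... | yes _  = atom⊑atom
... | no i≢i = ⊥-elim (i≢i refl)
⊓-greatest atom⊑atom atom⊑up   = atom⊑atom
⊓-greatest atom⊑up   atom⊑atom = atom⊑atom
⊓-greatest atom⊑up   atom⊑up   = atom⊑up
⊓-greatest (up⊑up p) (up⊑up q) = up⊑up (⊓-greatest p q)

⊑greatest : ∀ {n} {ks : Vec ℕ n} (x : Stack ks) → x ⊑ greatest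
⊑greatest top      = top⊑top
⊑greatest bot      = bot⊑
⊑greatest (atom i) = atom⊑up
⊑greatest (up x)   = up⊑up (⊑greatest x)

stackLattice : ∀ {n} (ks : Vec ℕ n) → Ord.Lattice _ _ _
stackLattice ks = record
  { Carrier   = Stack ks
  ; _≈_       = _≡_
  ; _≤_       = _⊑_
  ; _∨_       = _⊔_
  ; _∧_       = _⊓_
  ; isLattice = record
    { isPartialOrder = record
      { isPreorder = record
        { isEquivalence = isEquivalence
        ; reflexive     = λ { refl → ⊑-refl }
        ; trans         = ⊑-trans
        }
      ; antisym = ⊑-antisym
      }
    ; supremum = λ x y → x⊑x⊔y x y , y⊑x⊔y x y , λ _ → ⊔-least
    ; infimum  = λ x y → x⊓y⊑x x y , x⊓y⊑y x y , λ _ → ⊓-greatest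
    }
  }

-- Stacks as finite bounded lattices

card : ∀ {n} → Vec ℕ n → ℕ
card []       = 1
card (k ∷ ks) = 1 + (k + card ks)

enumerate : ∀ {n} (ks : Vec ℕ n) → Fin (card ks) ↔ Stack ks
enumerate [] = ↔-trans 1↔⊤ (mk↔ₛ′ (λ _ → top) _ (λ { top → refl }) (λ _ → refl))
enumerate (k ∷ ks) =
  ↔-trans +↔⊎ (↔-trans (1↔⊤ ⊎-↔ ↔-trans +↔⊎ (↔-refl ⊎-↔ enumerate ks))
    (mk↔ₛ′
      (λ { (inj₁ _) → bot ; (inj₂ (inj₁ i)) → atom i ; (inj₂ (inj₂ x)) → up x })
      (λ { bot → inj₁ tt ; (atom i) → inj₂ (inj₁ i) ; (up x) → inj₂ (inj₂ x) })
      (λ { bot → refl ; (atom i) → refl ; (up x) → refl })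
      (λ { (inj₁ _) → refl ; (inj₂ (inj₁ i)) → refl ; (inj₂ (inj₂ x)) → refl })))

module _ {n} (ks : Vec ℕ n) where
  open Inverse (enumerate ks) public
    using ()
    renaming ( to to decode; from to encode
             ; strictlyInverseˡ to decode-encode; strictlyInverseʳ to encode-decode )

  decode-injective : ∀ {x y} → decode x ≡ decode y → x ≡ y
  decode-injective {x} {y} e =
    trans (sym (encode-decode x)) (trans (cong encode e) (encode-decode y))

-- The operations are transported along `enumerate`. As `decode` is an injective homomorphism, the
-- lattice laws are pulled back from `Stack ks`.
stack : ∀ {n} → Vec ℕ n → FinBLat
stack ks = record
  { size = card ks
  ; _∨_ = _∨_
  ; _∧_ = _∧_
  ; 𝟘 = encode ks least
  ; 𝟙 = encode ks greatest
  ; isLattice = LatticeMonomorphism.isLattice {L₁ = raw} {L₂ = Lattice.rawLattice alg}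
      record
      { isLatticeHomomorphism = record
        { isRelHomomorphism = record { cong = cong (decode ks) }
        ; ∧-homo = λ x y → decode-encode ks (decode ks x ⊓ decode ks y)
        ; ∨-homo = λ x y → decode-encode ks (decode ks x ⊔ decode ks y)
        }
      ; injective = decode-injective ks
      }
      (Lattice.isLattice alg)
  ; ∨-identity = ∨-identityˡ , λ x → trans
      (cong (encode ks) (Lattice.∨-comm alg (decode ks x) (decode ks (encode ks least))))
      (∨-identityˡ x)
  ; ∧-identity = ∧-identityˡ , λ x → trans
      (cong (encode ks) (Lattice.∧-comm alg (decode ks x) (decode ks (encode ks greatest))))
      (∧-identityˡ x)
  }
  where
  alg : Lattice _ _
  alg = OrdLatticeProperties.algLattice (stackLattice ks)

  _∨_ _∧_ : Fin (card ks) → Fin (card ks) → Fin (card ks)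
  x ∨ y = encode ks (decode ks x ⊔ decode ks y)
  x ∧ y = encode ks (decode ks x ⊓ decode ks y)

  raw : RawLattice _ _
  raw = record { Carrier = Fin (card ks) ; _≈_ = _≡_ ; _∧_ = _∧_ ; _∨_ = _∨_ }

  least-identity : (x : Stack ks) → least ⊔ x ≡ x
  least-identity x = ⊑-antisym (⊔-least least⊑ ⊑-refl) (y⊑x⊔y least x)

  greatest-identity : (x : Stack ks) → greatest ⊓ x ≡ x
  greatest-identity x = ⊑-antisym (x⊓y⊑y greatest x) (⊓-greatest (⊑greatest x) ⊑-refl)

  ∨-identityˡ : ∀ x → encode ks least ∨ x ≡ x
  ∨-identityˡ x = trans
    (cong (encode ks) (trans
      (cong (_⊔ decode ks x) (decode-encode ks least)) (least-identity (decode ks x))))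
    (encode-decode ks x)

  ∧-identityˡ : ∀ x → encode ks greatest ∧ x ≡ x
  ∧-identityˡ x = trans
    (cong (encode ks) (trans
      (cong (_⊓ decode ks x) (decode-encode ks greatest)) (greatest-identity (decode ks x))))
    (encode-decode ks x)

-- Emptying one block

-- Without atoms, block `i` is a two-element chain. Every element of the new stack lies either below
-- its bottom or above its top, which cuts the stack into an ideal and a prime filter.
emptied : ∀ {n} → Vec ℕ n → Fin n → Vec ℕ n
emptied ks i = ks [ i ]≔ 0

include : ∀ {n} (ks : Vec ℕ n) i → Stack (emptied ks i) → Stack ks
include (k ∷ ks) zero    bot      = bot
include (k ∷ ks) zero    (up x)   = up x
include (k ∷ ks) (suc i) bot      = bot
include (k ∷ ks) (suc i) (atom j) = atom j
include (k ∷ ks) (suc i) (up x)   = up (include ks i x)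

include-injective : ∀ {n} (ks : Vec ℕ n) i {x y} → include ks i x ≡ include ks i y → x ≡ y
include-injective (k ∷ ks) zero    {bot}    {bot}    e    = refl
include-injective (k ∷ ks) zero    {up x}   {up y}   refl = refl
include-injective (k ∷ ks) (suc i) {bot}    {bot}    e    = refl
include-injective (k ∷ ks) (suc i) {atom j} {atom l} refl = refl
include-injective (k ∷ ks) (suc i) {up x}   {up y}   e    =
  cong up (include-injective ks i (up-injective e))
  where
  up-injective : ∀ {x y : Stack ks} → up {k = k} x ≡ up y → x ≡ y
  up-injective refl = refl

include-least : ∀ {n} (ks : Vec ℕ n) i → include ks i least ≡ least
include-least (k ∷ ks) zero    = refl
include-least (k ∷ ks) (suc i) = refl

include-greatest : ∀ {n} (ks : Vec ℕ n) i → include ks i greatest ≡ greatest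
include-greatest (k ∷ ks) zero    = refl
include-greatest (k ∷ ks) (suc i) = cong up (include-greatest ks i)

include-⊔ : ∀ {n} (ks : Vec ℕ n) i x y → include ks i (x ⊔ y) ≡ include ks i x ⊔ include ks i y
include-⊔ (k ∷ ks) zero    bot      y        = refl
include-⊔ (k ∷ ks) zero    (up x)   bot      = refl
include-⊔ (k ∷ ks) zero    (up x)   (up y)   = refl
include-⊔ (k ∷ ks) (suc i) bot      y        = refl
include-⊔ (k ∷ ks) (suc i) (atom j) bot      = refl
include-⊔ (k ∷ ks) (suc i) (atom j) (atom l) with j ≟ l
... | yes _ = refl
... | no  _ = cong up (include-least ks i)
include-⊔ (k ∷ ks) (suc i) (atom j) (up y)   = refl
include-⊔ (k ∷ ks) (suc i) (up x)   bot      = refl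
include-⊔ (k ∷ ks) (suc i) (up x)   (atom l) = refl
include-⊔ (k ∷ ks) (suc i) (up x)   (up y)   = cong up (include-⊔ ks i x y)

include-⊓ : ∀ {n} (ks : Vec ℕ n) i x y → include ks i (x ⊓ y) ≡ include ks i x ⊓ include ks i y
include-⊓ (k ∷ ks) zero    bot      y        = refl
include-⊓ (k ∷ ks) zero    (up x)   bot      = refl
include-⊓ (k ∷ ks) zero    (up x)   (up y)   = refl
include-⊓ (k ∷ ks) (suc i) bot      y        = refl
include-⊓ (k ∷ ks) (suc i) (atom j) bot      = refl
include-⊓ (k ∷ ks) (suc i) (atom j) (atom l) with j ≟ l
... | yes _ = refl
... | no  _ = refl
include-⊓ (k ∷ ks) (suc i) (atom j) (up y)   = refl
include-⊓ (k ∷ ks) (suc i) (up x)   bot      = refl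
include-⊓ (k ∷ ks) (suc i) (up x)   (atom l) = refl
include-⊓ (k ∷ ks) (suc i) (up x)   (up y)   = cong up (include-⊓ ks i x y)

-- Only the value at atoms matters; elsewhere the block index is arbitrary.
block : ∀ {n} {ks : Vec ℕ n} → Stack ks → ℕ
block (up x) = suc (block x)
block _      = 0

include-image : ∀ {n} (ks : Vec ℕ n) i (x : Stack ks) → block x ≢ toℕ i → ∃ λ y → include ks i y ≡ x
include-image (k ∷ ks) zero    bot      _ = bot , refl
include-image (k ∷ ks) zero    (atom j) p = ⊥-elim (p refl)
include-image (k ∷ ks) zero    (up x)   _ = up x , refl
include-image (k ∷ ks) (suc i) bot      _ = bot , refl
include-image (k ∷ ks) (suc i) (atom j) _ = atom j , refl
include-image (k ∷ ks) (suc i) (up x)   p =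
  let y , e = include-image ks i x (p ∘ cong suc) in up y , cong up e

module _ {n} (ks : Vec ℕ n) (i : Fin n) where
  private
    ks⁻ : Vec ℕ n
    ks⁻ = emptied ks i

  includeᶠ : Fin (card ks⁻) → Fin (card ks)
  includeᶠ x = encode ks (include ks i (decode ks⁻ x))

  includeᶠ-injective : ∀ {x y} → includeᶠ x ≡ includeᶠ y → x ≡ y
  includeᶠ-injective e = decode-injective ks⁻ (include-injective ks i
    (trans (sym (decode-encode ks _)) (trans (cong (decode ks) e) (decode-encode ks _))))

  includeᶠ-encode : ∀ x → includeᶠ (encode ks⁻ x) ≡ encode ks (include ks i x)
  includeᶠ-encode x = cong (encode ks ∘ include ks i) (decode-encode ks⁻ x)

  includeᶠ-isHom : IsHom (stack ks⁻) (stack ks) includeᶠ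
  includeᶠ-isHom = record
    { pres-∨ = λ x y → let u = decode ks⁻ x; v = decode ks⁻ y in
        trans (includeᶠ-encode (u ⊔ v)) (cong (encode ks) (trans (include-⊔ ks i u v)
          (sym (cong₂ _⊔_ (decode-encode ks (include ks i u)) (decode-encode ks (include ks i v))))))
    ; pres-∧ = λ x y → let u = decode ks⁻ x; v = decode ks⁻ y in
        trans (includeᶠ-encode (u ⊓ v)) (cong (encode ks) (trans (include-⊓ ks i u v)
          (sym (cong₂ _⊓_ (decode-encode ks (include ks i u)) (decode-encode ks (include ks i v))))))
    ; pres-𝟘 = trans (includeᶠ-encode least) (cong (encode ks) (include-least ks i))
    ; pres-𝟙 = trans (includeᶠ-encode greatest) (cong (encode ks) (include-greatest ks i))
    }

-- Homomorphisms from stacks into `L`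

module _ (L : FinBLat) where
  open FinBLat L hiding (size)
  open LatticeProperties (lattice L) using (∨-idem; ∧-idem)

  -- The characteristic function of the prime filter above the emptied block.
  prime : ∀ {n} (ks : Vec ℕ n) i → Stack (emptied ks i) → Fin (size L)
  prime (k ∷ ks) zero    bot      = 𝟘
  prime (k ∷ ks) zero    (up x)   = 𝟙
  prime (k ∷ ks) (suc i) bot      = 𝟘
  prime (k ∷ ks) (suc i) (atom j) = 𝟘
  prime (k ∷ ks) (suc i) (up x)   = prime ks i x

  prime-least : ∀ {n} (ks : Vec ℕ n) i → prime ks i least ≡ 𝟘
  prime-least (k ∷ ks) zero    = refl
  prime-least (k ∷ ks) (suc i) = refl

  prime-greatest : ∀ {n} (ks : Vec ℕ n) i → prime ks i greatest ≡ 𝟙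
  prime-greatest (k ∷ ks) zero    = refl
  prime-greatest (k ∷ ks) (suc i) = prime-greatest ks i

  𝟘-zero : ∀ x → 𝟘 ∧ x ≡ 𝟘
  𝟘-zero x = trans (cong (𝟘 ∧_) (sym (proj₁ ∨-identity x))) (Lattice.∧-absorbs-∨ (lattice L) 𝟘 x)

  prime-⊔ : ∀ {n} (ks : Vec ℕ n) i x y → prime ks i (x ⊔ y) ≡ prime ks i x ∨ prime ks i y
  prime-⊔ (k ∷ ks) zero    bot      y        = sym (proj₁ ∨-identity _)
  prime-⊔ (k ∷ ks) zero    (up x)   bot      = sym (proj₂ ∨-identity _)
  prime-⊔ (k ∷ ks) zero    (up x)   (up y)   = sym (∨-idem _)
  prime-⊔ (k ∷ ks) (suc i) bot      y        = sym (proj₁ ∨-identity _)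
  prime-⊔ (k ∷ ks) (suc i) (atom j) bot      = sym (proj₁ ∨-identity _)
  prime-⊔ (k ∷ ks) (suc i) (atom j) (atom l) with j ≟ l
  ... | yes _ = sym (proj₁ ∨-identity _)
  -- The critical case for primeness: two distinct atoms below the cut join to the bottom of the
  -- next block, which is still outside the filter.
  ... | no  _ = trans (prime-least ks i) (sym (proj₁ ∨-identity _))
  prime-⊔ (k ∷ ks) (suc i) (atom j) (up y)   = sym (proj₁ ∨-identity _)
  prime-⊔ (k ∷ ks) (suc i) (up x)   bot      = sym (proj₂ ∨-identity _)
  prime-⊔ (k ∷ ks) (suc i) (up x)   (atom l) = sym (proj₂ ∨-identity _)
  prime-⊔ (k ∷ ks) (suc i) (up x)   (up y)   = prime-⊔ ks i x y

  prime-⊓ : ∀ {n} (ks : Vec ℕ n) i x y → prime ks i (x ⊓ y) ≡ prime ks i x ∧ prime ks i y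
  prime-⊓ (k ∷ ks) zero    bot      y        = sym (𝟘-zero _)
  prime-⊓ (k ∷ ks) zero    (up x)   bot      = sym (proj₁ ∧-identity _)
  prime-⊓ (k ∷ ks) zero    (up x)   (up y)   = sym (∧-idem _)
  prime-⊓ (k ∷ ks) (suc i) bot      y        = sym (𝟘-zero _)
  prime-⊓ (k ∷ ks) (suc i) (atom j) bot      = sym (𝟘-zero _)
  prime-⊓ (k ∷ ks) (suc i) (atom j) (atom l) with j ≟ l
  ... | yes _ = sym (𝟘-zero _)
  ... | no  _ = sym (𝟘-zero _)
  prime-⊓ (k ∷ ks) (suc i) (atom j) (up y)   = sym (𝟘-zero _)
  prime-⊓ (k ∷ ks) (suc i) (up x)   bot      =
    sym (trans (Lattice.∧-comm (lattice L) _ _) (𝟘-zero _))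
  prime-⊓ (k ∷ ks) (suc i) (up x)   (atom l) =
    sym (trans (Lattice.∧-comm (lattice L) _ _) (𝟘-zero _))
  prime-⊓ (k ∷ ks) (suc i) (up x)   (up y)   = prime-⊓ ks i x y

  emptied-homTo : ∀ {n} (ks : Vec ℕ n) i → HomTo (stack (emptied ks i)) L
  emptied-homTo {n} ks i = prime ks i ∘ decode ks⁻ , record
    { pres-∨ = λ x y → let u = decode ks⁻ x; v = decode ks⁻ y in
        trans (prime-encode (u ⊔ v)) (prime-⊔ ks i u v)
    ; pres-∧ = λ x y → let u = decode ks⁻ x; v = decode ks⁻ y in
        trans (prime-encode (u ⊓ v)) (prime-⊓ ks i u v)
    ; pres-𝟘 = trans (prime-encode least) (prime-least ks i)
    ; pres-𝟙 = trans (prime-encode greatest) (prime-greatest ks i)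
    }
    where
    ks⁻ : Vec ℕ n
    ks⁻ = emptied ks i

    prime-encode : ∀ x → prime ks i (decode ks⁻ (encode ks⁻ x)) ≡ prime ks i x
    prime-encode x = cong (prime ks i) (decode-encode ks⁻ x)

  -- Each block has more atoms than `L` has elements. The hypotheses concern `⊔` and `⊓` alone, so
  -- they pass directly to `f ∘ up`, the restriction to the blocks above, and the induction proceeds
  -- block by block.
  collapse : ∀ n (f : Stack (replicate n (suc (size L))) → Fin (size L)) →
             (∀ x y → f (x ⊔ y) ≡ f x ∨ f y) → (∀ x y → f (x ⊓ y) ≡ f x ∧ f y) →
             f least ≡ f greatest
  collapse zero    f f-⊔ f-⊓ = refl
  collapse (suc n) f f-⊔ f-⊓ with pigeonhole (n<1+n (size L)) (f ∘ atom)
  -- By idempotence, the common value of the two atoms equals both the value of their meet `bot` and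
  -- the value of their join `up least`.
  ... | i , j , i<j , fi≡fj = begin
    f bot                    ≡⟨ cong f (atoms-⊓ i≢j) ⟨
    f (atom i ⊓ atom j)      ≡⟨ f-⊓ (atom i) (atom j) ⟩
    f (atom i) ∧ f (atom j)  ≡⟨ cong (f (atom i) ∧_) fi≡fj ⟨
    f (atom i) ∧ f (atom i)  ≡⟨ ∧-idem _ ⟩
    f (atom i)               ≡⟨ ∨-idem _ ⟨
    f (atom i) ∨ f (atom i)  ≡⟨ cong (f (atom i) ∨_) fi≡fj ⟩
    f (atom i) ∨ f (atom j)  ≡⟨ f-⊔ (atom i) (atom j) ⟨
    f (atom i ⊔ atom j)      ≡⟨ cong f (atoms-⊔ i≢j) ⟩
    f (up least)             ≡⟨ collapse n (f ∘ up) (λ x y → f-⊔ (up x) (up y))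
                                                    (λ x y → f-⊓ (up x) (up y)) ⟩
    f (up greatest)          ∎
    where
    open ≡-Reasoning
    i≢j : i ≢ j
    i≢j = Fin.<⇒≢ i<j
    atoms-⊓ : ∀ {m k} {ks : Vec ℕ m} {i j : Fin k} → i ≢ j → atom {ks = ks} i ⊓ atom j ≡ bot
    atoms-⊓ {i = i} {j} i≢j with i ≟ j
    ... | yes i≡j = ⊥-elim (i≢j i≡j)
    ... | no  _   = refl
    atoms-⊔ : ∀ {m k} {ks : Vec ℕ m} {i j : Fin k} → i ≢ j → atom {ks = ks} i ⊔ atom j ≡ up least
    atoms-⊔ {i = i} {j} i≢j with i ≟ j
    ... | yes i≡j = ⊥-elim (i≢j i≡j)
    ... | no  _   = refl

  nontrivial : 2 ≤ size L → 𝟘 ≢ 𝟙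
  -- The constant map to a one-element set makes the pigeonhole principle return two distinct
  -- elements of `L`.
  nontrivial 2≤ 𝟘≡𝟙 with pigeonhole 2≤ (λ _ → zero {0})
  ... | x , y , x<y , _ = Fin.<⇒≢ x<y (trans (≡𝟘 x) (sym (≡𝟘 y)))
    where
    ≡𝟘 : ∀ x → x ≡ 𝟘
    ≡𝟘 x = trans (sym (proj₁ ∧-identity x)) (trans (cong (_∧ x) (sym 𝟘≡𝟙)) (𝟘-zero x))

  stack-noHom : 2 ≤ size L → ∀ n → ¬ HomTo (stack (replicate n (suc (size L)))) L
  stack-noHom 2≤ n (f , f-hom) = nontrivial 2≤
    (trans (sym pres-𝟘) (trans (collapse n (f ∘ encode ks) f-⊔ f-⊓) pres-𝟙))
    where
    open IsHom f-hom
    ks : Vec ℕ n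
    ks = replicate n (suc (size L))
    f-⊔ : ∀ x y → f (encode ks (x ⊔ y)) ≡ f (encode ks x) ∨ f (encode ks y)
    f-⊔ x y = trans
      (cong (f ∘ encode ks) (sym (cong₂ _⊔_ (decode-encode ks x) (decode-encode ks y))))
      (pres-∨ (encode ks x) (encode ks y))
    f-⊓ : ∀ x y → f (encode ks (x ⊓ y)) ≡ f (encode ks x) ∧ f (encode ks y)
    f-⊓ x y = trans
      (cong (f ∘ encode ks) (sym (cong₂ _⊓_ (decode-encode ks x) (decode-encode ks y))))
      (pres-∧ (encode ks x) (encode ks y))

-- Failure of universal definability

-- Otherwise every `i` would be hit, and choosing for each `i` some `j` that hits it would inject
-- `Fin (suc n)` into `Fin n`.
missed : ∀ {n} (g : Fin n → ℕ) → ∃ λ (i : Fin (suc n)) → ∀ j → g j ≢ toℕ i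
missed {n} g with any? (λ i → all? (λ j → ¬? (g j ℕ.≟ toℕ i)))
... | yes found = found
... | no  none  = ⊥-elim (let i , i′ , i<i′ , e = pigeonhole (n<1+n n) (proj₁ ∘ hit) in
    Fin.<⇒≢ i<i′ (toℕ-injective
      (trans (sym (proj₂ (hit i))) (trans (cong g e) (proj₂ (hit i′))))))
  where
  hit : ∀ i → ∃ λ j → g j ≡ toℕ i
  hit i =
    let j , ¬≢ = ¬∀⟶∃¬ n _ (λ j → ¬? (g j ℕ.≟ toℕ i)) (λ p → none (i , p))
    in j , decidable-stable (g j ℕ.≟ toℕ i) ¬≢

not-universal : (L : FinBLat) → 2 ≤ size L →
                ¬ Σ Sentence (λ φ → Universal φ × DefinesRel𝒦 (ℍ← L) φ)
not-universal L 2≤ (φ , u , defines) =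
  stack-noHom L 2≤ (suc n) (proj₂ (defines (stack ks)) (universal⁺ (stack ks) u _ λ xs _ → holds xs))
  where
  n = arity u

  -- One block more than the matrix has variables, so that some block is avoided; one atom per block
  -- more than `L` has elements, so that two atoms are identified.
  ks : Vec ℕ (suc n)
  ks = replicate (suc n) (suc (size L))

  holds : ∀ xs → Sat (stack ks) xs (matrix u)
  -- The sentence holds in `N`, which maps to `L`; its matrix therefore holds at the preimages `ys`,
  -- and the embedding carries it to `xs`.
  holds xs = Embedding.QF-preserved (includeᶠ-isHom ks i) (includeᶠ-injective ks i) h-ys (matrix-QF u)
    (universal⁻ N u _ (proj₁ (defines N) (emptied-homTo L ks i)) ys (λ ()))
    where
    avoiding = missed (λ j → block (decode ks (xs j)))
    i = proj₁ avoiding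
    N = stack (emptied ks i)

    preimage : ∀ j → ∃ λ y → include ks i y ≡ decode ks (xs j)
    preimage j = include-image ks i (decode ks (xs j)) (proj₂ avoiding j)

    ys : Env N n
    ys j = encode (emptied ks i) (proj₁ (preimage j))

    h-ys : ∀ j → includeᶠ ks i (ys j) ≡ xs j
    h-ys j = trans (includeᶠ-encode ks i _)
      (trans (cong (encode ks) (proj₂ (preimage j))) (encode-decode ks (xs j)))

theorem3p1 : (L : FinBLat) → 2 ≤ size L →
    Σ Sentence (λ φ → DefinesRel𝒦 (ℍ← L) φ)
    × ¬ Σ Sentence (λ φ → Universal φ × DefinesRel𝒦 (ℍ← L) φ)
theorem3p1 L 2≤ =
  (Definability.homSentence L , Definability.homSentence-defines L) , not-universal L 2≤
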